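{- For every $n \in \mathbb{N}$, $(n,n-2)$-HSFs do not exist; that is, every $(n,n-2)$-PTF $f$ satisfies $\mathbf{D}[f] \le \mathbf{D}[f^*_{n,n-2}]$.
   Context: A boolean function $f:\{ -1,1\}^n\to\{ -1,1\}$ is an $(n,d)$-PTF if there is a polynomial $p\in\mathbb{R}[x_1,\dots,x_n]$ of degree at most $d$ with $f(x)=\mathrm{sgn}(p(x))$ for all $x\in\{ -1,1\}^n$. The dichromatic count $\mathbf{D}[f]$ is the number of unordered pairs $\{x,y\}$ of points of $\{ -1,1\}^n$ differing in exactly one coordinate with $f(x)\ne f(y)$. Let $p^*_{n,d}$ be the monic univariate polynomial of degree $d$ with (non-repeated) roots at the $d$ integers closest to $0$ of opposite parity from $n$, and let $f^*_{n,d}(x)=\mathrm{sgn}\left(p^*_{n,d}\left(\sum_{i=1}^n x_i\right)\right)$. An $(n,d)$-HSF is an $(n,d)$-PTF $f$ with $\mathbf{D}[f] > \mathbf{D}[f^*_{n,d}]$.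
   Formalization: The polynomial $p$ in the definition of an $(n,d)$-PTF has rational coefficients instead of real ones. -}

module Defs where

open import Data.Nat as ℕ using (ℕ; zero; suc; _∸_)
open import Data.Integer as ℤ using (ℤ)
open import Data.Rational as ℚ using (ℚ; 0ℚ; 1ℚ)
open import Data.Sign as Sign using (Sign)
open import Data.Fin using (Fin)
open import Data.Vec as Vec using (Vec; []; _∷_; lookup; _[_]≔_)
open import Data.List as List using (List; []; _∷_; allFin; concatMap; length; filter)
open import Data.List.Relation.Unary.All using (All)
open import Data.Product using (_×_; _,_; ∃; Σ-syntax)
open import Relation.Nullary using (Dec; yes; no; ¬_)
open import Relation.Nullary.Decidable using (_×-dec_; ¬?)
open import Relation.Binary.PropositionalEquality using (_≡_)

-- Points of the cube {-1,1}^n : vectors of signs (Sign.- is -1, Sign.+ is +1).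
Point : ℕ → Set
Point n = Vec Sign n

-- Enumeration of all 2^n points of the cube.
cube : (n : ℕ) → List (Point n)
cube zero    = [] ∷ []
cube (suc n) = concatMap (λ v → (Sign.+ ∷ v) ∷ (Sign.- ∷ v) ∷ []) (cube n)

-- A sign as a rational number ±1, and as an integer.
signℚ : Sign → ℚ
signℚ Sign.+ = 1ℚ
signℚ Sign.- = ℚ.- 1ℚ

signℤ : Sign → ℤ
signℤ Sign.+ = ℤ.+ 1
signℤ Sign.- = ℤ.- (ℤ.+ 1)

-- Natural powers in ℚ.
powℚ : ℚ → ℕ → ℚ
powℚ q zero    = 1ℚ
powℚ q (suc k) = q ℚ.* powℚ q k

-- A polynomial in n variables with rational coefficients, given as a finite
-- list of monomials (coefficient, exponent vector).
Monomial : ℕ → Set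
Monomial n = ℚ × Vec ℕ n

Poly : ℕ → Set
Poly n = List (Monomial n)

-- total degree of a monomial
mdeg : ∀ {n} → Vec ℕ n → ℕ
mdeg []       = 0
mdeg (e ∷ es) = e ℕ.+ mdeg es

-- "p has degree at most d": every monomial has total degree ≤ d
DegreeAtMost : ∀ {n} → ℕ → Poly n → Set
DegreeAtMost d p = All (λ m → mdeg (Data.Product.proj₂ m) ℕ.≤ d) p

monoVal : ∀ {n} → Vec ℕ n → Point n → ℚ
monoVal []       []       = 1ℚ
monoVal (e ∷ es) (s ∷ xs) = powℚ (signℚ s) e ℚ.* monoVal es xs

evalPoly : ∀ {n} → Poly n → Point n → ℚ
evalPoly []             x = 0ℚ
evalPoly ((c , e) ∷ ms) x = c ℚ.* monoVal e x ℚ.+ evalPoly ms x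

-- f(x) = sgn(p(x)) with f valued in {-1,1}: p(x) > 0 where f(x) = +1 and
-- p(x) < 0 where f(x) = -1.
SignRepresents : ∀ {n} → Poly n → (Point n → Sign) → Set
SignRepresents {n} p f =
  ∀ (x : Point n) → (f x ≡ Sign.+ → 0ℚ ℚ.< evalPoly p x)
                  × (f x ≡ Sign.- → evalPoly p x ℚ.< 0ℚ)

-- (n,d)-PTF
IsPTF : (n d : ℕ) → (Point n → Sign) → Set
IsPTF n d f = Σ[ p ∈ Poly n ] (DegreeAtMost d p × SignRepresents p f)

-- Dichromatic count: number of edges {x, y} of the cube (x, y differ in exactly
-- one coordinate i) with f x ≠ f y.  Each edge is counted once, through its
-- endpoint x with x_i = +1 (y = x with coordinate i set to -1).
dichromatic : (n : ℕ) → (Point n → Sign) → ℕ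
dichromatic n f =
  length (filter (λ xi → let x = Data.Product.proj₁ xi ; i = Data.Product.proj₂ xi in
                   (lookup x i Sign.≟ Sign.+) ×-dec ¬? (f x Sign.≟ f (x [ i ]≔ Sign.-)))
                 (concatMap (λ x → List.map (λ i → x , i) (allFin n)) (cube n)))

-- Candidate roots ordered by distance from 0 (ties broken towards the positive
-- one): for n odd the even integers 0, 2, -2, 4, -4, ...; for n even the odd
-- integers 1, -1, 3, -3, ....  The k-th candidate:
-- alt b : +b, -b, +(b+2), -(b+2), +(b+4), ...
alt : ℕ → ℕ → ℤ
alt b zero          = ℤ.+ b
alt b (suc zero)    = ℤ.- (ℤ.+ b)
alt b (suc (suc k)) = alt (b ℕ.+ 2) k

candEven : ℕ → ℤ         -- 0, 2, -2, 4, -4, ...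
candEven zero    = ℤ.+ 0
candEven (suc k) = alt 2 k

candOdd : ℕ → ℤ          -- 1, -1, 3, -3, ...
candOdd = alt 1

-- the d integers closest to 0 of parity opposite to n
starRoots : (n d : ℕ) → List ℤ
starRoots n d = List.map cand (List.upTo d)
  where cand : ℕ → ℤ
        cand k with n ℕ.% 2
        ... | zero = candOdd k
        ... | _    = candEven k

-- p*_{n,d}(t) = ∏_{r ∈ starRoots n d} (t - r), evaluated at an integer t
pStar : (n d : ℕ) → ℤ → ℤ
pStar n d t = List.foldr (λ r acc → (t ℤ.- r) ℤ.* acc) (ℤ.+ 1) (starRoots n d)

sumPoint : ∀ {n} → Point n → ℤ
sumPoint []       = ℤ.+ 0
sumPoint (s ∷ xs) = signℤ s ℤ.+ sumPoint xs

-- sign of an integer (the value at 0 is never used: p*(Σ x_i) ≠ 0 on the cube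
-- by parity)
sgnℤ : ℤ → Sign
sgnℤ (ℤ.+ _)     = Sign.+
sgnℤ ℤ.-[1+ _ ] = Sign.-

fStar : (n d : ℕ) → Point n → Sign
fStar n d x = sgnℤ (pStar n d (sumPoint x))

module Submission where

-- Let n ≥ 2, let f = sgn p with deg p ≤ n − 2, and write χ(x) = x₁⋯xₙ.  Since χ changes sign along
-- every edge, an edge is dichromatic for f exactly when it is monochromatic for f·χ, so
-- 𝐃[f] + 𝐃[f·χ] is the number of edges of the cube; it therefore suffices to show
-- 𝐃[f*·χ] ≤ 2n ≤ 𝐃[f·χ].
--
-- On a facet {xᵢ = s}, χ is (up to sign) the parity function of the remaining n − 1 variables,
-- which is orthogonal to the restriction of p, a polynomial of degree < n − 1.  So χ·p, whose
-- sign is f·χ, sums to zero over the facet, and f·χ cannot be constant there.  A non-constant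
-- function on the (n−1)-cube has at least n − 1 dichromatic edges, and every edge of the n-cube
-- lies in exactly n − 1 facets; summing over the 2n facets gives (n−1)·𝐃[f·χ] ≥ 2n(n−1).
--
-- The roots of p* are the n − 2 integers of parity opposite to n in (−(n−2), n−2).  At a point
-- with a + 1 coordinates +1 and b + 1 coordinates −1 (a + b = n − 2), exactly b of them exceed
-- Σxᵢ = a − b, so f*(x) = (−1)^b = −χ(x).  Hence f*·χ = −1 away from the two constant points,
-- and 𝐃[f*·χ] ≤ 2n.
--
-- For n ≤ 1 the polynomial p is constant, and so is f.

open import Defs
open import Algebra.Bundles using (CommutativeMonoid)
open import Data.Fin as Fin using (Fin)
open import Data.Integer as ℤ using (ℤ; _⊖_; _◃_; ∣_∣; -[1+_])
import Data.Integer.Properties as ℤP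
open import Data.List as List using (List; []; _∷_; allFin; concatMap; filter; length; tabulate)
import Data.List.Properties as ListP
open import Data.List.Relation.Unary.All as All using (All; []; _∷_)
import Data.List.Relation.Unary.All.Properties as AllP
open import Data.Nat using (ℕ; zero; suc; _+_; _*_; _^_; _∸_; _≤_; _<_; z≤n; s≤s)
open import Data.Nat.DivMod using (_%_; m*n%n≡0; [m+kn]%n≡m%n)
open import Data.Nat.ListAction using (sum)
import Data.Nat.ListAction.Properties as ListActionP
open import Data.Nat.Properties
open import Data.Nat.Tactic.RingSolver using (solve-∀)
open import Data.Product using (∃; ∃₂; _×_; _,_; proj₁; proj₂)
open import Data.Rational as ℚ using (ℚ; 0ℚ; 1ℚ)
import Data.Rational.Properties as ℚP
open import Data.Sign as Sign using (Sign; opposite)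
import Data.Sign.Properties as SignP
open import Data.Sum using (_⊎_; inj₁; inj₂)
open import Data.Vec as Vec using (Vec; []; _∷_; insertAt; removeAt; lookup; _[_]≔_)
open import Data.Vec.Properties using (∷-injectiveʳ)
open import Function using (_∘_; id)
open import Relation.Binary.PropositionalEquality
open import Relation.Nullary using (Dec; yes; no; ¬_; contradiction)
open import Relation.Nullary.Decidable using (_×-dec_; ¬?)
open import Relation.Unary using (Decidable)

import Algebra.Properties.CommutativeMonoid.Sum +-0-commutativeMonoid as FinSum
import Algebra.Properties.CommutativeSemigroup

_⁺ _⁻ : ∀ {a n} {A : Set a} → (Point (suc n) → A) → Point n → A
(h ⁺) v = h (Sign.+ ∷ v)
(h ⁻) v = h (Sign.- ∷ v)

facet : ∀ {a n} {A : Set a} → (Point (suc n) → A) → Fin (suc n) → Sign → Point n → A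
facet h i s v = h (insertAt v i s)

-- Sums over the cube

module CubeSum {c ℓ} (M : CommutativeMonoid c ℓ) where

  open CommutativeMonoid M
    using (Carrier; _≈_; _∙_; ε; ∙-cong; identityˡ; identityʳ; commutativeSemigroup)
    renaming (refl to ≈-refl; trans to ≈-trans; setoid to ≈-setoid)
  open import Algebra.Properties.CommutativeSemigroup commutativeSemigroup using (interchange)
  open import Relation.Binary.Reasoning.Setoid ≈-setoid

  ∑ : (n : ℕ) → (Point n → Carrier) → Carrier
  ∑ zero    φ = φ []
  ∑ (suc n) φ = ∑ n (φ ⁺) ∙ ∑ n (φ ⁻)

  ∑-cong : ∀ n {φ ψ : Point n → Carrier} → (∀ x → φ x ≈ ψ x) → ∑ n φ ≈ ∑ n ψ
  ∑-cong zero    φ≈ψ = φ≈ψ []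
  ∑-cong (suc n) φ≈ψ = ∙-cong (∑-cong n (φ≈ψ ∘ (Sign.+ ∷_))) (∑-cong n (φ≈ψ ∘ (Sign.- ∷_)))

  ∑-distrib : ∀ n (φ ψ : Point n → Carrier) → ∑ n (λ x → φ x ∙ ψ x) ≈ ∑ n φ ∙ ∑ n ψ
  ∑-distrib zero    φ ψ = ≈-refl
  ∑-distrib (suc n) φ ψ = begin
    ∑ n (λ v → φ (Sign.+ ∷ v) ∙ ψ (Sign.+ ∷ v)) ∙ ∑ n (λ v → φ (Sign.- ∷ v) ∙ ψ (Sign.- ∷ v))
      ≈⟨ ∙-cong (∑-distrib n (φ ⁺) (ψ ⁺)) (∑-distrib n (φ ⁻) (ψ ⁻)) ⟩
    (∑ n (φ ⁺) ∙ ∑ n (ψ ⁺)) ∙ (∑ n (φ ⁻) ∙ ∑ n (ψ ⁻))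
      ≈⟨ interchange _ _ _ _ ⟩
    ∑ (suc n) φ ∙ ∑ (suc n) ψ ∎

  ∑-facets : ∀ n (φ : Point (suc n) → Carrier) i →
             ∑ (suc n) φ ≈ ∑ n (facet φ i Sign.+) ∙ ∑ n (facet φ i Sign.-)
  ∑-facets n       φ Fin.zero    = ≈-refl
  ∑-facets (suc n) φ (Fin.suc i) = begin
    ∑ (suc n) (φ ⁺) ∙ ∑ (suc n) (φ ⁻)
      ≈⟨ ∙-cong (∑-facets n (φ ⁺) i) (∑-facets n (φ ⁻) i) ⟩
    (∑ n (facet (φ ⁺) i Sign.+) ∙ ∑ n (facet (φ ⁺) i Sign.-)) ∙
    (∑ n (facet (φ ⁻) i Sign.+) ∙ ∑ n (facet (φ ⁻) i Sign.-))
      ≈⟨ interchange _ _ _ _ ⟩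
    ∑ (suc n) (facet φ (Fin.suc i) Sign.+) ∙ ∑ (suc n) (facet φ (Fin.suc i) Sign.-) ∎

  ∑-ε : ∀ n → ∑ n (λ _ → ε) ≈ ε
  ∑-ε zero    = ≈-refl
  ∑-ε (suc n) = ≈-trans (∙-cong (∑-ε n) (∑-ε n)) (identityˡ ε)

  ∑-point : ∀ n (φ : Point n → Carrier) a → (∀ x → x ≢ a → φ x ≈ ε) → ∑ n φ ≈ φ a
  ∑-point zero    φ []           _    = ≈-refl
  ∑-point (suc n) φ (Sign.+ ∷ a) φ≈ε = begin
    ∑ n (φ ⁺) ∙ ∑ n (φ ⁻)
      ≈⟨ ∙-cong (∑-point n (φ ⁺) a (λ x x≢a → φ≈ε (Sign.+ ∷ x) (x≢a ∘ ∷-injectiveʳ)))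
                (≈-trans (∑-cong n (λ x → φ≈ε (Sign.- ∷ x) λ ())) (∑-ε n)) ⟩
    φ (Sign.+ ∷ a) ∙ ε
      ≈⟨ identityʳ _ ⟩
    φ (Sign.+ ∷ a) ∎
  ∑-point (suc n) φ (Sign.- ∷ a) φ≈ε = begin
    ∑ n (φ ⁺) ∙ ∑ n (φ ⁻)
      ≈⟨ ∙-cong (≈-trans (∑-cong n (λ x → φ≈ε (Sign.+ ∷ x) λ ())) (∑-ε n))
                (∑-point n (φ ⁻) a (λ x x≢a → φ≈ε (Sign.- ∷ x) (x≢a ∘ ∷-injectiveʳ))) ⟩
    ε ∙ φ (Sign.- ∷ a)
      ≈⟨ identityˡ _ ⟩
    φ (Sign.- ∷ a) ∎

open CubeSum +-0-commutativeMonoid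

∑-1≡2^n : ∀ n → ∑ n (λ _ → 1) ≡ 2 ^ n
∑-1≡2^n zero    = refl
∑-1≡2^n (suc n) = trans (cong₂ _+_ (∑-1≡2^n n) (∑-1≡2^n n)) (cong (2 ^ n +_) (sym (+-identityʳ (2 ^ n))))

∑-mono-≤ : ∀ n {φ ψ : Point n → ℕ} → (∀ x → φ x ≤ ψ x) → ∑ n φ ≤ ∑ n ψ
∑-mono-≤ zero    φ≤ψ = φ≤ψ []
∑-mono-≤ (suc n) φ≤ψ =
  +-mono-≤ (∑-mono-≤ n (φ≤ψ ∘ (Sign.+ ∷_))) (∑-mono-≤ n (φ≤ψ ∘ (Sign.- ∷_)))

term≤∑ : ∀ n (φ : Point n → ℕ) x → φ x ≤ ∑ n φ
term≤∑ zero    φ []           = ≤-refl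
term≤∑ (suc n) φ (Sign.+ ∷ x) = ≤-trans (term≤∑ n (φ ⁺) x) (m≤m+n _ _)
term≤∑ (suc n) φ (Sign.- ∷ x) = ≤-trans (term≤∑ n (φ ⁻) x) (m≤n+m _ _)

-- The dichromatic count, by recursion on the first coordinate

differ : Sign → Sign → ℕ
differ Sign.+ Sign.+ = 0
differ Sign.+ Sign.- = 1
differ Sign.- Sign.+ = 1
differ Sign.- Sign.- = 0

differ-self : ∀ s → differ s s ≡ 0
differ-self Sign.+ = refl
differ-self Sign.- = refl

differ-≢ : ∀ {a b} → a ≢ b → differ a b ≡ 1
differ-≢ {Sign.+} {Sign.+} a≢b = contradiction refl a≢b
differ-≢ {Sign.+} {Sign.-} _   = refl
differ-≢ {Sign.-} {Sign.+} _   = refl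
differ-≢ {Sign.-} {Sign.-} a≢b = contradiction refl a≢b

differ≤1 : ∀ a b → differ a b ≤ 1
differ≤1 Sign.+ Sign.+ = z≤n
differ≤1 Sign.+ Sign.- = ≤-refl
differ≤1 Sign.- Sign.+ = ≤-refl
differ≤1 Sign.- Sign.- = z≤n

differ-comm : ∀ a b → differ a b ≡ differ b a
differ-comm Sign.+ Sign.+ = refl
differ-comm Sign.+ Sign.- = refl
differ-comm Sign.- Sign.+ = refl
differ-comm Sign.- Sign.- = refl

differ-opposite : ∀ a b → differ (opposite a) (opposite b) ≡ differ a b
differ-opposite Sign.+ Sign.+ = refl
differ-opposite Sign.+ Sign.- = refl
differ-opposite Sign.- Sign.+ = refl
differ-opposite Sign.- Sign.- = refl

differ-triangle : ∀ a b c → differ a b ≤ differ a c + differ b c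
differ-triangle Sign.+ Sign.+ c      = z≤n
differ-triangle Sign.- Sign.- c      = z≤n
differ-triangle Sign.+ Sign.- Sign.+ = ≤-refl
differ-triangle Sign.+ Sign.- Sign.- = ≤-refl
differ-triangle Sign.- Sign.+ Sign.+ = ≤-refl
differ-triangle Sign.- Sign.+ Sign.- = ≤-refl

crossing : ∀ {n} → (Point (suc n) → Sign) → Point n → ℕ
crossing h v = differ (h (Sign.+ ∷ v)) (h (Sign.- ∷ v))

D : (n : ℕ) → (Point n → Sign) → ℕ
D zero    h = 0
D (suc n) h = D n (h ⁺) + D n (h ⁻) + ∑ n (crossing h)

D-cong : ∀ n {h h′ : Point n → Sign} → (∀ x → h x ≡ h′ x) → D n h ≡ D n h′
D-cong zero    h≡h′ = refl
D-cong (suc n) h≡h′ = cong₂ _+_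
  (cong₂ _+_ (D-cong n (h≡h′ ∘ (Sign.+ ∷_))) (D-cong n (h≡h′ ∘ (Sign.- ∷_))))
  (∑-cong n (λ v → cong₂ differ (h≡h′ (Sign.+ ∷ v)) (h≡h′ (Sign.- ∷ v))))

D-const : ∀ n c → D n (λ _ → c) ≡ 0
D-const zero    c = refl
D-const (suc n) c = cong₂ _+_ (cong₂ _+_ (D-const n c) (D-const n c))
                              (trans (∑-cong n (λ _ → differ-self c)) (∑-ε n))

D-opposite : ∀ n (h : Point n → Sign) → D n (opposite ∘ h) ≡ D n h
D-opposite zero    h = refl
D-opposite (suc n) h = cong₂ _+_
  (cong₂ _+_ (D-opposite n (h ⁺)) (D-opposite n (h ⁻)))
  (∑-cong n (λ v → differ-opposite (h (Sign.+ ∷ v)) (h (Sign.- ∷ v))))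

indicator : ∀ {p} {P : Set p} → Dec P → ℕ
indicator (yes _) = 1
indicator (no _)  = 0

CutAt : ∀ {n} → (Point n → Sign) → Point n × Fin n → Set
CutAt f (x , i) = lookup x i ≡ Sign.+ × f x ≢ f (x [ i ]≔ Sign.-)

cutAt? : ∀ {n} (f : Point n → Sign) → Decidable (CutAt f)
cutAt? f (x , i) = (lookup x i Sign.≟ Sign.+) ×-dec ¬? (f x Sign.≟ f (x [ i ]≔ Sign.-))

cutsAt : ∀ {n} → (Point n → Sign) → Point n → ℕ
cutsAt f x = FinSum.sum (λ i → indicator (cutAt? f (x , i)))

length-filter-concatMap : ∀ {a b p} {A : Set a} {B : Set b} {P : B → Set p} (P? : Decidable P)
                          (F : A → List B) xs →
                          length (filter P? (concatMap F xs)) ≡ sum (List.map (length ∘ filter P? ∘ F) xs)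
length-filter-concatMap P? F []       = refl
length-filter-concatMap P? F (x ∷ xs) = begin
  length (filter P? (F x List.++ concatMap F xs))
    ≡⟨ cong length (ListP.filter-++ P? (F x) (concatMap F xs)) ⟩
  length (filter P? (F x) List.++ filter P? (concatMap F xs))
    ≡⟨ ListP.length-++ (filter P? (F x)) ⟩
  length (filter P? (F x)) + length (filter P? (concatMap F xs))
    ≡⟨ cong (length (filter P? (F x)) +_) (length-filter-concatMap P? F xs) ⟩
  sum (List.map (length ∘ filter P? ∘ F) (x ∷ xs)) ∎
  where open ≡-Reasoning

length-filter-tabulate : ∀ {a p} {A : Set a} {P : A → Set p} (P? : Decidable P) {n} (g : Fin n → A) →
                         length (filter P? (tabulate g)) ≡ FinSum.sum (λ i → indicator (P? (g i)))
length-filter-tabulate P? {zero}  g = refl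
length-filter-tabulate P? {suc n} g with P? (g Fin.zero)
... | yes _ = cong suc (length-filter-tabulate P? (g ∘ Fin.suc))
... | no  _ = length-filter-tabulate P? (g ∘ Fin.suc)

sum-concatMap : ∀ {a} {A : Set a} (F : A → List ℕ) xs → sum (concatMap F xs) ≡ sum (List.map (sum ∘ F) xs)
sum-concatMap F []       = refl
sum-concatMap F (x ∷ xs) =
  trans (ListActionP.sum-++ (F x) (concatMap F xs)) (cong (sum (F x) +_) (sum-concatMap F xs))

sum-map-cube : ∀ n (φ : Point n → ℕ) → sum (List.map φ (cube n)) ≡ ∑ n φ
sum-map-cube zero    φ = +-identityʳ (φ [])
sum-map-cube (suc n) φ = begin
  sum (List.map φ (concatMap (λ v → (Sign.+ ∷ v) ∷ (Sign.- ∷ v) ∷ []) (cube n)))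
    ≡⟨ cong sum (ListP.map-concatMap φ _ (cube n)) ⟩
  sum (concatMap (λ v → φ (Sign.+ ∷ v) ∷ φ (Sign.- ∷ v) ∷ []) (cube n))
    ≡⟨ sum-concatMap _ (cube n) ⟩
  sum (List.map (λ v → φ (Sign.+ ∷ v) + (φ (Sign.- ∷ v) + 0)) (cube n))
    ≡⟨ sum-map-cube n _ ⟩
  ∑ n (λ v → φ (Sign.+ ∷ v) + (φ (Sign.- ∷ v) + 0))
    ≡⟨ ∑-cong n (λ v → cong (φ (Sign.+ ∷ v) +_) (+-identityʳ _)) ⟩
  ∑ n (λ v → φ (Sign.+ ∷ v) + φ (Sign.- ∷ v))
    ≡⟨ ∑-distrib n (φ ⁺) (φ ⁻) ⟩
  ∑ (suc n) φ ∎
  where open ≡-Reasoning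

cutsAt-+∷ : ∀ {n} (f : Point (suc n) → Sign) v → cutsAt f (Sign.+ ∷ v) ≡ crossing f v + cutsAt (f ⁺) v
cutsAt-+∷ f v with f (Sign.+ ∷ v) | f (Sign.- ∷ v)
... | Sign.+ | Sign.+ = refl
... | Sign.+ | Sign.- = refl
... | Sign.- | Sign.+ = refl
... | Sign.- | Sign.- = refl

-- The direction-0 edge at − ∷ v is counted from its other endpoint + ∷ v, so cutsAt f (− ∷ v)
-- reduces to cutsAt (f ⁻) v.
∑-cutsAt≡D : ∀ n (f : Point n → Sign) → ∑ n (cutsAt f) ≡ D n f
∑-cutsAt≡D zero    f = refl
∑-cutsAt≡D (suc n) f = begin
  ∑ n (λ v → cutsAt f (Sign.+ ∷ v)) + ∑ n (cutsAt (f ⁻))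
    ≡⟨ cong (_+ ∑ n (cutsAt (f ⁻)))
            (trans (∑-cong n (cutsAt-+∷ f)) (∑-distrib n (crossing f) (cutsAt (f ⁺)))) ⟩
  ∑ n (crossing f) + ∑ n (cutsAt (f ⁺)) + ∑ n (cutsAt (f ⁻))
    ≡⟨ cong₂ (λ a b → ∑ n (crossing f) + a + b) (∑-cutsAt≡D n (f ⁺)) (∑-cutsAt≡D n (f ⁻)) ⟩
  ∑ n (crossing f) + D n (f ⁺) + D n (f ⁻)
    ≡⟨ rotate (∑ n (crossing f)) _ _ ⟩
  D (suc n) f ∎
  where
  open ≡-Reasoning
  rotate : ∀ a b c → a + b + c ≡ b + c + a
  rotate = solve-∀

dichromatic≡D : ∀ n (f : Point n → Sign) → dichromatic n f ≡ D n f
dichromatic≡D n f = begin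
  length (filter (cutAt? f) (concatMap edgesAt (cube n)))
    ≡⟨ length-filter-concatMap (cutAt? f) edgesAt (cube n) ⟩
  sum (List.map (length ∘ filter (cutAt? f) ∘ edgesAt) (cube n))
    ≡⟨ sum-map-cube n _ ⟩
  ∑ n (length ∘ filter (cutAt? f) ∘ edgesAt)
    ≡⟨ ∑-cong n (λ x → cong (length ∘ filter (cutAt? f)) (ListP.map-tabulate id (x ,_))) ⟩
  ∑ n (λ x → length (filter (cutAt? f) (tabulate (x ,_))))
    ≡⟨ ∑-cong n (λ x → length-filter-tabulate (cutAt? f) (x ,_)) ⟩
  ∑ n (cutsAt f)
    ≡⟨ ∑-cutsAt≡D n f ⟩
  D n f ∎
  where
  open ≡-Reasoning
  edgesAt : Point n → List (Point n × Fin n)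
  edgesAt x = List.map (x ,_) (allFin n)

-- Twisting by the parity character χ

χ : ∀ {n} → Point n → Sign
χ []      = Sign.+
χ (s ∷ x) = s Sign.* χ x

_·χ : ∀ {n} → (Point n → Sign) → Point n → Sign
(h ·χ) x = h x Sign.* χ x

*-opposite : ∀ s t → s Sign.* opposite t ≡ opposite (s Sign.* t)
*-opposite Sign.+ t = refl
*-opposite Sign.- t = refl

edgeCount : ℕ → ℕ
edgeCount zero    = 0
edgeCount (suc n) = edgeCount n + edgeCount n + 2 ^ n

differ+differ·χ : ∀ a b c → differ a b + differ (a Sign.* c) (b Sign.* opposite c) ≡ 1
differ+differ·χ Sign.+ Sign.+ Sign.+ = refl
differ+differ·χ Sign.+ Sign.+ Sign.- = refl
differ+differ·χ Sign.+ Sign.- Sign.+ = refl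
differ+differ·χ Sign.+ Sign.- Sign.- = refl
differ+differ·χ Sign.- Sign.+ Sign.+ = refl
differ+differ·χ Sign.- Sign.+ Sign.- = refl
differ+differ·χ Sign.- Sign.- Sign.+ = refl
differ+differ·χ Sign.- Sign.- Sign.- = refl

D+D·χ : ∀ n (h : Point n → Sign) → D n h + D n (h ·χ) ≡ edgeCount n
D+D·χ zero    h = refl
D+D·χ (suc n) h = begin
  (D n (h ⁺) + D n (h ⁻) + ∑ n (crossing h)) + (D n (h ⁺ ·χ) + D n ((h ·χ) ⁻) + ∑ n (crossing (h ·χ)))
    ≡⟨ cong (λ d → (D n (h ⁺) + D n (h ⁻) + ∑ n (crossing h)) + (D n (h ⁺ ·χ) + d + ∑ n (crossing (h ·χ))))
            (trans (D-cong n (λ v → *-opposite (h (Sign.- ∷ v)) (χ v))) (D-opposite n (h ⁻ ·χ))) ⟩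
  (D n (h ⁺) + D n (h ⁻) + ∑ n (crossing h)) + (D n (h ⁺ ·χ) + D n (h ⁻ ·χ) + ∑ n (crossing (h ·χ)))
    ≡⟨ regroup (D n (h ⁺)) (D n (h ⁻)) (∑ n (crossing h)) _ _ _ ⟩
  (D n (h ⁺) + D n (h ⁺ ·χ)) + (D n (h ⁻) + D n (h ⁻ ·χ)) + (∑ n (crossing h) + ∑ n (crossing (h ·χ)))
    ≡⟨ cong₂ _+_ (cong₂ _+_ (D+D·χ n (h ⁺)) (D+D·χ n (h ⁻))) crossings ⟩
  edgeCount (suc n) ∎
  where
  open ≡-Reasoning
  regroup : ∀ a b c a′ b′ c′ → (a + b + c) + (a′ + b′ + c′) ≡ (a + a′) + (b + b′) + (c + c′)
  regroup = solve-∀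
  crossings : ∑ n (crossing h) + ∑ n (crossing (h ·χ)) ≡ 2 ^ n
  crossings = begin
    ∑ n (crossing h) + ∑ n (crossing (h ·χ))
      ≡⟨ ∑-distrib n (crossing h) (crossing (h ·χ)) ⟨
    ∑ n (λ v → crossing h v + crossing (h ·χ) v)
      ≡⟨ ∑-cong n (λ v → differ+differ·χ (h (Sign.+ ∷ v)) (h (Sign.- ∷ v)) (χ v)) ⟩
    ∑ n (λ _ → 1)
      ≡⟨ ∑-1≡2^n n ⟩
    2 ^ n ∎

-- Every dichromatic edge has an endpoint where h differs from c, and every point lies on n edges.
D≤n*∑differ : ∀ n (h : Point n → Sign) c → D n h ≤ n * ∑ n (λ x → differ (h x) c)
D≤n*∑differ zero    h c = z≤n
D≤n*∑differ (suc n) h c = begin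
  D n (h ⁺) + D n (h ⁻) + ∑ n (crossing h)
    ≤⟨ +-mono-≤ (+-mono-≤ (D≤n*∑differ n (h ⁺) c) (D≤n*∑differ n (h ⁻) c)) crossing≤ ⟩
  n * N₊ + n * N₋ + (N₊ + N₋)
    ≡⟨ collect n N₊ N₋ ⟩
  suc n * (N₊ + N₋) ∎
  where
  open ≤-Reasoning
  N₊ = ∑ n (λ v → differ (h (Sign.+ ∷ v)) c)
  N₋ = ∑ n (λ v → differ (h (Sign.- ∷ v)) c)
  crossing≤ : ∑ n (crossing h) ≤ N₊ + N₋
  crossing≤ = ≤-trans (∑-mono-≤ n (λ v → differ-triangle (h (Sign.+ ∷ v)) (h (Sign.- ∷ v)) c))
                      (≤-reflexive (∑-distrib n _ _))
  collect : ∀ n a b → n * a + n * b + (a + b) ≡ suc n * (a + b)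
  collect = solve-∀

-- Non-constant functions and facets

NonConstant : ∀ {n} → (Point n → Sign) → Set
NonConstant h = ∃₂ λ x y → h x ≢ h y

nonConstant⇒0<n : ∀ {n} {h : Point n → Sign} → NonConstant h → 0 < n
nonConstant⇒0<n {zero}  ([] , [] , h[]≢h[]) = contradiction refl h[]≢h[]
nonConstant⇒0<n {suc n} _                    = s≤s z≤n

constant-or-witness : ∀ n (h : Point n → Sign) c → (∀ x → h x ≡ c) ⊎ ∃ λ x → h x ≢ c
constant-or-witness zero    h c with h [] Sign.≟ c
... | yes h[]≡c = inj₁ λ { [] → h[]≡c }
... | no  h[]≢c = inj₂ ([] , h[]≢c)
constant-or-witness (suc n) h c with constant-or-witness n (h ⁺) c | constant-or-witness n (h ⁻) c
... | inj₂ (x , h⁺x≢c) | _                = inj₂ (Sign.+ ∷ x , h⁺x≢c)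
... | inj₁ _           | inj₂ (x , h⁻x≢c) = inj₂ (Sign.- ∷ x , h⁻x≢c)
... | inj₁ h⁺≡c        | inj₁ h⁻≡c        =
  inj₁ λ { (Sign.+ ∷ x) → h⁺≡c x ; (Sign.- ∷ x) → h⁻≡c x }

¬constant⇒nonConstant : ∀ n (h : Point n → Sign) → (∀ c → ¬ (∀ x → h x ≡ c)) → NonConstant h
¬constant⇒nonConstant n h ¬constant with constant-or-witness n h (h x₀)
  where x₀ = Vec.replicate n Sign.+
... | inj₁ h≡hx₀        = contradiction h≡hx₀ (¬constant _)
... | inj₂ (x , hx≢hx₀) = x , _ , hx≢hx₀

n<2^n : ∀ n → n < 2 ^ n
n<2^n zero    = s≤s z≤n
n<2^n (suc n) = begin-strict
  suc n           ≤⟨ n<2^n n ⟩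
  2 ^ n           <⟨ m<m+n (2 ^ n) (m^n>0 2 n) ⟩
  2 ^ n + 2 ^ n   ≡⟨ cong (2 ^ n +_) (+-identityʳ (2 ^ n)) ⟨
  2 ^ suc n       ∎
  where open ≤-Reasoning

D-swap : ∀ n (h : Point (suc n) → Sign) →
         D n (h ⁻) + D n (h ⁺) + ∑ n (λ v → differ (h (Sign.- ∷ v)) (h (Sign.+ ∷ v))) ≡ D (suc n) h
D-swap n h = cong₂ _+_ (+-comm (D n (h ⁻)) (D n (h ⁺)))
                       (∑-cong n (λ v → differ-comm (h (Sign.- ∷ v)) (h (Sign.+ ∷ v))))

-- On the (n+1)-cube: if one half is non-constant, it contains n dichromatic edges by induction and
-- the other half or the crossing edges supply one more; if both halves are constant, all 2^n
-- crossing edges are dichromatic.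
nonConstant⇒n≤D : ∀ n (h : Point n → Sign) → NonConstant h → n ≤ D n h
nonConstant-half⇒n<D : ∀ n (p q : Point n → Sign) → NonConstant p →
                       n < D n p + D n q + ∑ n (λ v → differ (p v) (q v))

nonConstant⇒n≤D zero    h _ = z≤n
nonConstant⇒n≤D (suc n) h (s ∷ x , t ∷ y , hx≢hy)
  with constant-or-witness n (h ⁺) (h (Sign.+ ∷ x)) | constant-or-witness n (h ⁻) (h (Sign.- ∷ x))
... | inj₂ (z , h⁺z≢h⁺x) | _ = nonConstant-half⇒n<D n (h ⁺) (h ⁻) (z , x , h⁺z≢h⁺x)
... | inj₁ _ | inj₂ (z , h⁻z≢h⁻x) =
  subst (n <_) (D-swap n h) (nonConstant-half⇒n<D n (h ⁻) (h ⁺) (z , x , h⁻z≢h⁻x))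
... | inj₁ h⁺≡a | inj₁ h⁻≡b = begin
  suc n             ≤⟨ n<2^n n ⟩
  2 ^ n             ≡⟨ ∑-1≡2^n n ⟨
  ∑ n (λ _ → 1)     ≡⟨ ∑-cong n crossing≡1 ⟨
  ∑ n (crossing h)  ≤⟨ m≤n+m _ _ ⟩
  D (suc n) h       ∎
  where
  open ≤-Reasoning
  a≢b : h (Sign.+ ∷ x) ≢ h (Sign.- ∷ x)
  a≢b a≡b = hx≢hy (trans (constant s x) (sym (constant t y)))
    where
    constant : ∀ r v → h (r ∷ v) ≡ h (Sign.+ ∷ x)
    constant Sign.+ v = h⁺≡a v
    constant Sign.- v = trans (h⁻≡b v) (sym a≡b)
  crossing≡1 : ∀ v → crossing h v ≡ 1
  crossing≡1 v = differ-≢ λ h⁺v≡h⁻v → a≢b (trans (sym (h⁺≡a v)) (trans h⁺v≡h⁻v (h⁻≡b v)))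

nonConstant-half⇒n<D n p q p-nonConstant@(u , w , pu≢pw) = begin
  suc n                                            ≡⟨ +-comm 1 n ⟩
  n + 1                                            ≤⟨ +-mono-≤ (nonConstant⇒n≤D n p p-nonConstant) extra-edge ⟩
  D n p + (D n q + ∑ n (λ v → differ (p v) (q v))) ≡⟨ +-assoc (D n p) _ _ ⟨
  D n p + D n q + ∑ n (λ v → differ (p v) (q v))   ∎
  where
  open ≤-Reasoning
  extra-edge : 1 ≤ D n q + ∑ n (λ v → differ (p v) (q v))
  extra-edge with q u Sign.≟ p u | q w Sign.≟ p w
  ... | no qu≢pu | _ =
    ≤-trans (≤-reflexive (sym (differ-≢ (qu≢pu ∘ sym)))) (≤-trans (term≤∑ n _ u) (m≤n+m _ _))
  ... | yes _ | no qw≢pw =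
    ≤-trans (≤-reflexive (sym (differ-≢ (qw≢pw ∘ sym)))) (≤-trans (term≤∑ n _ w) (m≤n+m _ _))
  ... | yes qu≡pu | yes qw≡pw =
    ≤-trans (nonConstant⇒0<n q-nonConstant) (≤-trans (nonConstant⇒n≤D n q q-nonConstant) (m≤m+n _ _))
    where
    q-nonConstant : NonConstant q
    q-nonConstant = u , w , λ qu≡qw → pu≢pw (trans (sym qu≡pu) (trans qu≡qw qw≡pw))

facetD : ∀ n → (Point (suc n) → Sign) → Fin (suc n) → ℕ
facetD n h i = D n (facet h i Sign.+) + D n (facet h i Sign.-)

facetD-suc : ∀ n (h : Point (suc (suc n)) → Sign) j →
             facetD (suc n) h (Fin.suc j) ≡ facetD n (h ⁺) j + facetD n (h ⁻) j + ∑ (suc n) (crossing h)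
facetD-suc n h j = begin
  (A₊ + B₊ + C₊) + (A₋ + B₋ + C₋)
    ≡⟨ regroup A₊ B₊ C₊ A₋ B₋ C₋ ⟩
  (A₊ + A₋) + (B₊ + B₋) + (C₊ + C₋)
    ≡⟨ cong ((A₊ + A₋) + (B₊ + B₋) +_) (∑-facets n (crossing h) j) ⟨
  (A₊ + A₋) + (B₊ + B₋) + ∑ (suc n) (crossing h) ∎
  where
  open ≡-Reasoning
  A₊ = D n (facet (h ⁺) j Sign.+)
  A₋ = D n (facet (h ⁺) j Sign.-)
  B₊ = D n (facet (h ⁻) j Sign.+)
  B₋ = D n (facet (h ⁻) j Sign.-)
  C₊ = ∑ n (facet (crossing h) j Sign.+)
  C₋ = ∑ n (facet (crossing h) j Sign.-)
  regroup : ∀ a b c a′ b′ c′ → (a + b + c) + (a′ + b′ + c′) ≡ (a + a′) + (b + b′) + (c + c′)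
  regroup = solve-∀

sum-const : ∀ n c → FinSum.sum {n} (λ _ → c) ≡ n * c
sum-const zero    c = refl
sum-const (suc n) c = cong (c +_) (sum-const n c)

*≤sum : ∀ n {c} (φ : Fin n → ℕ) → (∀ i → c ≤ φ i) → n * c ≤ FinSum.sum φ
*≤sum zero    φ c≤φ = z≤n
*≤sum (suc n) φ c≤φ = +-mono-≤ (c≤φ Fin.zero) (*≤sum n (φ ∘ Fin.suc) (c≤φ ∘ Fin.suc))

-- Every edge of the (n+1)-cube lies in exactly n of its facets.
sum-facetD : ∀ n (h : Point (suc n) → Sign) → FinSum.sum (facetD n h) ≡ n * D (suc n) h
sum-facetD zero    h = refl
sum-facetD (suc n) h = begin
  (D₊ + D₋) + FinSum.sum (λ j → facetD (suc n) h (Fin.suc j))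
    ≡⟨ cong ((D₊ + D₋) +_) (FinSum.sum-cong-≗ (facetD-suc n h)) ⟩
  (D₊ + D₋) + FinSum.sum (λ j → facetD n (h ⁺) j + facetD n (h ⁻) j + C)
    ≡⟨ cong ((D₊ + D₋) +_) (trans (FinSum.∑-distrib-+ (λ j → facetD n (h ⁺) j + facetD n (h ⁻) j) (λ _ → C))
                                  (cong₂ _+_ (FinSum.∑-distrib-+ (facetD n (h ⁺)) (facetD n (h ⁻)))
                                             (sum-const (suc n) C))) ⟩
  (D₊ + D₋) + (FinSum.sum (facetD n (h ⁺)) + FinSum.sum (facetD n (h ⁻)) + suc n * C)
    ≡⟨ cong₂ (λ a b → (D₊ + D₋) + (a + b + suc n * C)) (sum-facetD n (h ⁺)) (sum-facetD n (h ⁻)) ⟩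
  (D₊ + D₋) + (n * D₊ + n * D₋ + suc n * C)
    ≡⟨ collect n D₊ D₋ C ⟩
  suc n * D (suc (suc n)) h ∎
  where
  open ≡-Reasoning
  D₊ = D (suc n) (h ⁺)
  D₋ = D (suc n) (h ⁻)
  C = ∑ (suc n) (crossing h)
  collect : ∀ n a b c → (a + b) + (n * a + n * b + suc n * c) ≡ suc n * (a + b + c)
  collect = solve-∀

nonConstantFacets⇒2N≤D : ∀ n (h : Point (suc n) → Sign) → (∀ i s → NonConstant (facet h i s)) →
                         suc n + suc n ≤ D (suc n) h
nonConstantFacets⇒2N≤D zero    h nonConstant with () ← nonConstant⇒0<n (nonConstant Fin.zero Sign.+)
nonConstantFacets⇒2N≤D (suc n) h nonConstant = *-cancelˡ-≤ (suc n) (begin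
  suc n * (suc (suc n) + suc (suc n))  ≡⟨ commute n ⟩
  suc (suc n) * (suc n + suc n)        ≤⟨ *≤sum (suc (suc n)) (facetD (suc n) h) facetD-bound ⟩
  FinSum.sum (facetD (suc n) h)        ≡⟨ sum-facetD (suc n) h ⟩
  suc n * D (suc (suc n)) h            ∎)
  where
  open ≤-Reasoning
  facetD-bound : ∀ i → suc n + suc n ≤ facetD (suc n) h i
  facetD-bound i = +-mono-≤ (nonConstant⇒n≤D (suc n) _ (nonConstant i Sign.+))
                            (nonConstant⇒n≤D (suc n) _ (nonConstant i Sign.-))
  commute : ∀ n → suc n * (suc (suc n) + suc (suc n)) ≡ suc (suc n) * (suc n + suc n)
  commute = solve-∀

-- Orthogonality of χ to polynomials of low degree

module ℚ∑ = CubeSum ℚP.+-0-commutativeMonoid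
open ℚ∑ using () renaming (∑ to ∑ℚ)
module ℚ* = Algebra.Properties.CommutativeSemigroup
              (CommutativeMonoid.commutativeSemigroup ℚP.*-1-commutativeMonoid)

signℚ-* : ∀ s t → signℚ (s Sign.* t) ≡ signℚ s ℚ.* signℚ t
signℚ-* Sign.+ Sign.+ = refl
signℚ-* Sign.+ Sign.- = refl
signℚ-* Sign.- Sign.+ = refl
signℚ-* Sign.- Sign.- = refl

∑ℚ-scale : ∀ n c (φ : Point n → ℚ) → ∑ℚ n (λ x → c ℚ.* φ x) ≡ c ℚ.* ∑ℚ n φ
∑ℚ-scale zero    c φ = refl
∑ℚ-scale (suc n) c φ = trans (cong₂ ℚ._+_ (∑ℚ-scale n c (φ ⁺)) (∑ℚ-scale n c (φ ⁻)))
                             (sym (ℚP.*-distribˡ-+ c (∑ℚ n (φ ⁺)) (∑ℚ n (φ ⁻))))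

∑ℚ-pos : ∀ n (φ : Point n → ℚ) → (∀ x → 0ℚ ℚ.< φ x) → 0ℚ ℚ.< ∑ℚ n φ
∑ℚ-pos zero    φ 0<φ = 0<φ []
∑ℚ-pos (suc n) φ 0<φ =
  ℚP.+-mono-< (∑ℚ-pos n (φ ⁺) (0<φ ∘ (Sign.+ ∷_))) (∑ℚ-pos n (φ ⁻) (0<φ ∘ (Sign.- ∷_)))

∑ℚ-neg : ∀ n (φ : Point n → ℚ) → (∀ x → φ x ℚ.< 0ℚ) → ∑ℚ n φ ℚ.< 0ℚ
∑ℚ-neg zero    φ φ<0 = φ<0 []
∑ℚ-neg (suc n) φ φ<0 =
  ℚP.+-mono-< (∑ℚ-neg n (φ ⁺) (φ<0 ∘ (Sign.+ ∷_))) (∑ℚ-neg n (φ ⁻) (φ<0 ∘ (Sign.- ∷_)))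

χ-weighted : ∀ {n} → (Point n → ℚ) → Point n → ℚ
χ-weighted φ x = signℚ (χ x) ℚ.* φ x

∑ℚ-χ-weighted-monoVal-∷ : ∀ n e₀ (e : Vec ℕ n) →
  ∑ℚ (suc n) (χ-weighted (monoVal (e₀ ∷ e))) ≡
  (1ℚ ℚ.* powℚ 1ℚ e₀) ℚ.* ∑ℚ n (χ-weighted (monoVal e)) ℚ.+
  (ℚ.- 1ℚ ℚ.* powℚ (ℚ.- 1ℚ) e₀) ℚ.* ∑ℚ n (χ-weighted (monoVal e))
∑ℚ-χ-weighted-monoVal-∷ n e₀ e = cong₂ ℚ._+_ (factor Sign.+) (factor Sign.-)
  where
  factor : ∀ s → ∑ℚ n (λ v → χ-weighted (monoVal (e₀ ∷ e)) (s ∷ v)) ≡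
                 (signℚ s ℚ.* powℚ (signℚ s) e₀) ℚ.* ∑ℚ n (χ-weighted (monoVal e))
  factor s = trans
    (ℚ∑.∑-cong n (λ v → trans (cong (ℚ._* (powℚ (signℚ s) e₀ ℚ.* monoVal e v)) (signℚ-* s (χ v)))
                              (ℚ*.interchange (signℚ s) (signℚ (χ v)) (powℚ (signℚ s) e₀) (monoVal e v))))
    (∑ℚ-scale n (signℚ s ℚ.* powℚ (signℚ s) e₀) (χ-weighted (monoVal e)))

χ-orthogonal-monoVal : ∀ n (e : Vec ℕ n) → mdeg e < n → ∑ℚ n (χ-weighted (monoVal e)) ≡ 0ℚ
χ-orthogonal-monoVal (suc n) (zero ∷ e) _ = begin
  ∑ℚ (suc n) (χ-weighted (monoVal (0 ∷ e)))  ≡⟨ ∑ℚ-χ-weighted-monoVal-∷ n 0 e ⟩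
  1ℚ ℚ.* S ℚ.+ ℚ.- 1ℚ ℚ.* S                ≡⟨ ℚP.*-distribʳ-+ S 1ℚ (ℚ.- 1ℚ) ⟨
  0ℚ ℚ.* S                                 ≡⟨ ℚP.*-zeroˡ S ⟩
  0ℚ                                       ∎
  where
  open ≡-Reasoning
  S = ∑ℚ n (χ-weighted (monoVal e))
χ-orthogonal-monoVal (suc n) (suc k ∷ e) (s≤s deg<) = begin
  ∑ℚ (suc n) (χ-weighted (monoVal (suc k ∷ e)))  ≡⟨ ∑ℚ-χ-weighted-monoVal-∷ n (suc k) e ⟩
  w₊ ℚ.* S ℚ.+ w₋ ℚ.* S                        ≡⟨ cong (λ S → w₊ ℚ.* S ℚ.+ w₋ ℚ.* S) S≡0 ⟩
  w₊ ℚ.* 0ℚ ℚ.+ w₋ ℚ.* 0ℚ                      ≡⟨ cong₂ ℚ._+_ (ℚP.*-zeroʳ w₊) (ℚP.*-zeroʳ w₋) ⟩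
  0ℚ                                           ∎
  where
  open ≡-Reasoning
  S = ∑ℚ n (χ-weighted (monoVal e))
  w₊ = 1ℚ ℚ.* powℚ 1ℚ (suc k)
  w₋ = ℚ.- 1ℚ ℚ.* powℚ (ℚ.- 1ℚ) (suc k)
  S≡0 : S ≡ 0ℚ
  S≡0 = χ-orthogonal-monoVal n e (≤-trans (s≤s (m≤n+m (mdeg e) k)) deg<)

χ-orthogonal : ∀ n (p : Poly n) → All (λ m → mdeg (proj₂ m) < n) p → ∑ℚ n (χ-weighted (evalPoly p)) ≡ 0ℚ
χ-orthogonal n []             []             =
  trans (ℚ∑.∑-cong n (λ x → ℚP.*-zeroʳ (signℚ (χ x)))) (ℚ∑.∑-ε n)
χ-orthogonal n ((c , e) ∷ ms) (deg< ∷ degs<) = begin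
  ∑ℚ n (λ x → signℚ (χ x) ℚ.* (c ℚ.* monoVal e x ℚ.+ evalPoly ms x))
    ≡⟨ ℚ∑.∑-cong n (λ x → trans (ℚP.*-distribˡ-+ (signℚ (χ x)) _ _)
                                (cong (ℚ._+ _) (ℚ*.x∙yz≈y∙xz (signℚ (χ x)) c (monoVal e x)))) ⟩
  ∑ℚ n (λ x → c ℚ.* χ-weighted (monoVal e) x ℚ.+ signℚ (χ x) ℚ.* evalPoly ms x)
    ≡⟨ ℚ∑.∑-distrib n _ _ ⟩
  ∑ℚ n (λ x → c ℚ.* χ-weighted (monoVal e) x) ℚ.+ ∑ℚ n (λ x → signℚ (χ x) ℚ.* evalPoly ms x)
    ≡⟨ cong₂ ℚ._+_ (trans (∑ℚ-scale n c _) (trans (cong (c ℚ.*_) (χ-orthogonal-monoVal n e deg<)) (ℚP.*-zeroʳ c)))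
                   (χ-orthogonal n ms degs<) ⟩
  0ℚ ℚ.+ 0ℚ
    ≡⟨ ℚP.+-identityʳ 0ℚ ⟩
  0ℚ ∎
  where open ≡-Reasoning

χ-insertAt : ∀ {n} (v : Point n) i s → χ (insertAt v i s) ≡ s Sign.* χ v
χ-insertAt v       Fin.zero    s = refl
χ-insertAt (Sign.+ ∷ v) (Fin.suc i) s = χ-insertAt v i s
χ-insertAt (Sign.- ∷ v) (Fin.suc i) s = trans (cong opposite (χ-insertAt v i s)) (sym (*-opposite s (χ v)))

restrict : ∀ {n} → Fin (suc n) → Sign → Poly (suc n) → Poly n
restrict i s = List.map λ (c , e) → c ℚ.* powℚ (signℚ s) (lookup e i) , removeAt e i

monoVal-insertAt : ∀ {n} (e : Vec ℕ (suc n)) (v : Point n) i s →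
                   monoVal e (insertAt v i s) ≡ powℚ (signℚ s) (lookup e i) ℚ.* monoVal (removeAt e i) v
monoVal-insertAt (e₀ ∷ e)           v       Fin.zero    s = refl
monoVal-insertAt (e₀ ∷ e@(_ ∷ _)) (t ∷ v) (Fin.suc i) s = begin
  powℚ (signℚ t) e₀ ℚ.* monoVal e (insertAt v i s)
    ≡⟨ cong (powℚ (signℚ t) e₀ ℚ.*_) (monoVal-insertAt e v i s) ⟩
  powℚ (signℚ t) e₀ ℚ.* (powℚ (signℚ s) (lookup e i) ℚ.* monoVal (removeAt e i) v)
    ≡⟨ ℚ*.x∙yz≈y∙xz (powℚ (signℚ t) e₀) (powℚ (signℚ s) (lookup e i)) (monoVal (removeAt e i) v) ⟩
  powℚ (signℚ s) (lookup e i) ℚ.* (powℚ (signℚ t) e₀ ℚ.* monoVal (removeAt e i) v) ∎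
  where open ≡-Reasoning

evalPoly-insertAt : ∀ {n} (p : Poly (suc n)) (v : Point n) i s →
                    evalPoly p (insertAt v i s) ≡ evalPoly (restrict i s p) v
evalPoly-insertAt []             v i s = refl
evalPoly-insertAt ((c , e) ∷ ms) v i s = cong₂ ℚ._+_
  (trans (cong (c ℚ.*_) (monoVal-insertAt e v i s)) (sym (ℚP.*-assoc c _ _)))
  (evalPoly-insertAt ms v i s)

mdeg-removeAt : ∀ {n} (e : Vec ℕ (suc n)) i → mdeg (removeAt e i) ≤ mdeg e
mdeg-removeAt (e₀ ∷ e)         Fin.zero    = m≤n+m (mdeg e) e₀
mdeg-removeAt (e₀ ∷ e@(_ ∷ _)) (Fin.suc i) = +-monoʳ-≤ e₀ (mdeg-removeAt e i)

restrict-degree : ∀ {n d} (p : Poly (suc n)) i s → All (λ m → mdeg (proj₂ m) < d) p →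
                  All (λ m → mdeg (proj₂ m) < d) (restrict i s p)
restrict-degree p i s degs< = AllP.map⁺ (All.map (λ {(_ , e)} deg< → ≤-trans (s≤s (mdeg-removeAt e i)) deg<) degs<)

χ-orthogonal-facet : ∀ n (p : Poly (suc n)) → All (λ m → mdeg (proj₂ m) < n) p → ∀ i s →
                     ∑ℚ n (facet (χ-weighted (evalPoly p)) i s) ≡ 0ℚ
χ-orthogonal-facet n p degs< i s = begin
  ∑ℚ n (λ v → signℚ (χ (insertAt v i s)) ℚ.* evalPoly p (insertAt v i s))
    ≡⟨ ℚ∑.∑-cong n (λ v → cong₂ ℚ._*_ (trans (cong signℚ (χ-insertAt v i s)) (signℚ-* s (χ v)))
                                       (evalPoly-insertAt p v i s)) ⟩
  ∑ℚ n (λ v → (signℚ s ℚ.* signℚ (χ v)) ℚ.* evalPoly (restrict i s p) v)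
    ≡⟨ ℚ∑.∑-cong n (λ v → ℚP.*-assoc (signℚ s) _ _) ⟩
  ∑ℚ n (λ v → signℚ s ℚ.* (signℚ (χ v) ℚ.* evalPoly (restrict i s p) v))
    ≡⟨ ∑ℚ-scale n (signℚ s) _ ⟩
  signℚ s ℚ.* ∑ℚ n (λ v → signℚ (χ v) ℚ.* evalPoly (restrict i s p) v)
    ≡⟨ cong (signℚ s ℚ.*_) (χ-orthogonal n (restrict i s p) (restrict-degree p i s degs<)) ⟩
  signℚ s ℚ.* 0ℚ
    ≡⟨ ℚP.*-zeroʳ (signℚ s) ⟩
  0ℚ ∎
  where open ≡-Reasoning

-1*q≡-q : ∀ q → ℚ.- 1ℚ ℚ.* q ≡ ℚ.- q
-1*q≡-q q = trans (sym (ℚP.neg-distribˡ-* 1ℚ q)) (cong ℚ.-_ (ℚP.*-identityˡ q))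

χ-weighted-sign : ∀ {n} (p : Poly n) {f} → SignRepresents p f → ∀ x →
                  ((f ·χ) x ≡ Sign.+ → 0ℚ ℚ.< χ-weighted (evalPoly p) x) ×
                  ((f ·χ) x ≡ Sign.- → χ-weighted (evalPoly p) x ℚ.< 0ℚ)
χ-weighted-sign p {f} rep x with f x in fx | χ x
... | Sign.+ | Sign.+ = (λ _ → subst (0ℚ ℚ.<_) (sym (ℚP.*-identityˡ _)) (proj₁ (rep x) fx)) , λ ()
... | Sign.- | Sign.+ = (λ ()) , λ _ → subst (ℚ._< 0ℚ) (sym (ℚP.*-identityˡ _)) (proj₂ (rep x) fx)
... | Sign.+ | Sign.- = (λ ()) , λ _ → subst (ℚ._< 0ℚ) (sym (-1*q≡-q _)) (ℚP.neg-antimono-< (proj₁ (rep x) fx))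
... | Sign.- | Sign.- = (λ _ → subst (0ℚ ℚ.<_) (sym (-1*q≡-q _)) (ℚP.neg-antimono-< (proj₂ (rep x) fx))) , λ ()

PTF-facet-nonConstant : ∀ n (p : Poly (suc n)) (f : Point (suc n) → Sign) → SignRepresents p f →
                        All (λ m → mdeg (proj₂ m) < n) p → ∀ i s → NonConstant (facet (f ·χ) i s)
PTF-facet-nonConstant n p f rep degs< i s = ¬constant⇒nonConstant n (facet (f ·χ) i s) ¬constant
  where
  ∑≡0 = χ-orthogonal-facet n p degs< i s
  ¬constant : ∀ c → ¬ (∀ v → facet (f ·χ) i s v ≡ c)
  ¬constant Sign.+ ≡+ =
    ℚP.<-irrefl (sym ∑≡0) (∑ℚ-pos n _ (λ v → proj₁ (χ-weighted-sign p rep (insertAt v i s)) (≡+ v)))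
  ¬constant Sign.- ≡- =
    ℚP.<-irrefl ∑≡0 (∑ℚ-neg n _ (λ v → proj₂ (χ-weighted-sign p rep (insertAt v i s)) (≡- v)))

monoVal-degree0 : ∀ {n} (e : Vec ℕ n) → mdeg e ≤ 0 → ∀ x → monoVal e x ≡ 1ℚ
monoVal-degree0 []       _  []      = refl
monoVal-degree0 (zero ∷ e) deg≤0 (s ∷ x) = trans (ℚP.*-identityˡ (monoVal e x)) (monoVal-degree0 e deg≤0 x)

evalPoly-degree0 : ∀ {n} (p : Poly n) → DegreeAtMost 0 p → ∀ x y → evalPoly p x ≡ evalPoly p y
evalPoly-degree0 []             []               x y = refl
evalPoly-degree0 ((c , e) ∷ ms) (deg≤0 ∷ degs≤0) x y = cong₂ ℚ._+_
  (cong (c ℚ.*_) (trans (monoVal-degree0 e deg≤0 x) (sym (monoVal-degree0 e deg≤0 y))))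
  (evalPoly-degree0 ms degs≤0 x y)

signRepresents-cong : ∀ {n} (p : Poly n) {f} → SignRepresents p f →
                      ∀ x y → evalPoly p x ≡ evalPoly p y → f x ≡ f y
signRepresents-cong p {f} rep x y px≡py with f x in fx | f y in fy
... | Sign.+ | Sign.+ = refl
... | Sign.- | Sign.- = refl
... | Sign.+ | Sign.- = contradiction (proj₁ (rep x) fx) (ℚP.<-asym (subst (ℚ._< 0ℚ) (sym px≡py) (proj₂ (rep y) fy)))
... | Sign.- | Sign.+ = contradiction (proj₁ (rep y) fy) (ℚP.<-asym (subst (ℚ._< 0ℚ) px≡py (proj₂ (rep x) fx)))

degree0-PTF-D≡0 : ∀ n (f : Point n → Sign) → IsPTF n 0 f → D n f ≡ 0
degree0-PTF-D≡0 n f (p , deg≤0 , rep) =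
  trans (D-cong n (λ x → signRepresents-cong p rep x x₀ (evalPoly-degree0 p deg≤0 x x₀))) (D-const n (f x₀))
  where x₀ = Vec.replicate n Sign.+

-- The sign of p* between its roots

-1^_ : ℕ → Sign
-1^ zero  = Sign.+
-1^ suc n = opposite (-1^ n)

-1^-+ : ∀ m n → -1^ (m + n) ≡ -1^ m Sign.* -1^ n
-1^-+ zero    n = refl
-1^-+ (suc m) n = trans (cong opposite (-1^-+ m n)) (opposite-*ˡ (-1^ m) (-1^ n))
  where
  opposite-*ˡ : ∀ a b → opposite (a Sign.* b) ≡ opposite a Sign.* b
  opposite-*ˡ Sign.+ b = refl
  opposite-*ˡ Sign.- b = SignP.opposite-involutive b

-1^-double : ∀ n → -1^ (n + n) ≡ Sign.+
-1^-double zero    = refl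
-1^-double (suc n) rewrite +-suc n n | SignP.opposite-involutive (-1^ (n + n)) = -1^-double n

-1^-+-even : ∀ a k i → k ≡ i + i → -1^ (a + k) ≡ -1^ a
-1^-+-even a k i refl = trans (-1^-+ a (i + i)) (trans (cong (-1^ a Sign.*_) (-1^-double i)) (SignP.*-identityʳ (-1^ a)))

-1^-+-odd : ∀ a i → -1^ (a + suc (i + i)) ≡ opposite (-1^ a)
-1^-+-odd a i = trans (cong -1^_ (+-suc a (i + i))) (cong opposite (-1^-+-even a (i + i) i refl))

HasSign : Sign → ℤ → Set
HasSign s z = ∃ λ k → z ≡ s ◃ suc k

HasSign-* : ∀ {s t i j} → HasSign s i → HasSign t j → HasSign (s Sign.* t) (i ℤ.* j)
HasSign-* {Sign.+} {Sign.+} (k , refl) (l , refl) = _ , refl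
HasSign-* {Sign.+} {Sign.-} (k , refl) (l , refl) = _ , refl
HasSign-* {Sign.-} {Sign.+} (k , refl) (l , refl) = _ , refl
HasSign-* {Sign.-} {Sign.-} (k , refl) (l , refl) = _ , refl

sgnℤ-HasSign : ∀ {s z} → HasSign s z → sgnℤ z ≡ s
sgnℤ-HasSign {Sign.+} (_ , refl) = refl
sgnℤ-HasSign {Sign.-} (_ , refl) = refl

HasSign-sign : ∀ t {k} → ∣ t ∣ ≡ suc k → HasSign (ℤ.sign t) t
HasSign-sign (ℤ.+ _)  refl = _ , refl
HasSign-sign -[1+ _ ] refl = _ , refl

⊖-HasSign⁺ : ∀ {m n} → n < m → HasSign Sign.+ (m ⊖ n)
⊖-HasSign⁺ {suc m} {zero}  _         = m , refl
⊖-HasSign⁺ {suc m} {suc n} (s≤s n<m) = subst (HasSign Sign.+) (sym (ℤP.[1+m]⊖[1+n]≡m⊖n m n)) (⊖-HasSign⁺ n<m)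

⊖-HasSign⁻ : ∀ {m n} → m < n → HasSign Sign.- (m ⊖ n)
⊖-HasSign⁻ {zero}  {suc n} _         = n , refl
⊖-HasSign⁻ {suc m} {suc n} (s≤s m<n) = subst (HasSign Sign.-) (sym (ℤP.[1+m]⊖[1+n]≡m⊖n m n)) (⊖-HasSign⁻ m<n)

pair-below : ∀ {s z} t c → ∣ t ∣ < suc c → HasSign s z →
             HasSign (opposite s) ((t ℤ.- ℤ.+ suc c) ℤ.* ((t ℤ.- ℤ.- ℤ.+ suc c) ℤ.* z))
pair-below (ℤ.+ a)  c a<c       hz =
  HasSign-* (subst (HasSign Sign.-) (ℤP.m-n≡m⊖n a (suc c)) (⊖-HasSign⁻ a<c))
            (HasSign-* {Sign.+} (a + c , cong ℤ.+_ (+-suc a c)) hz)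
pair-below -[1+ a ] c (s≤s a<c) hz = HasSign-* (suc (a + c) , refl)
  (HasSign-* {Sign.+} (subst (HasSign Sign.+) (sym (ℤP.[1+m]⊖[1+n]≡m⊖n c a)) (⊖-HasSign⁺ a<c)) hz)

pair-above : ∀ {s z} t c → suc c < ∣ t ∣ → HasSign s z →
             HasSign s ((t ℤ.- ℤ.+ suc c) ℤ.* ((t ℤ.- ℤ.- ℤ.+ suc c) ℤ.* z))
pair-above (ℤ.+ a)  c c<a       hz =
  HasSign-* {Sign.+} (subst (HasSign Sign.+) (ℤP.m-n≡m⊖n a (suc c)) (⊖-HasSign⁺ c<a))
                     (HasSign-* {Sign.+} (a + c , cong ℤ.+_ (+-suc a c)) hz)
pair-above {s} -[1+ a ] c (s≤s c<a) hz = subst (λ s → HasSign s _) (SignP.opposite-involutive s)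
  (HasSign-* (suc (a + c) , refl)
             (HasSign-* {Sign.-} (subst (HasSign Sign.-) (sym (ℤP.[1+m]⊖[1+n]≡m⊖n c a)) (⊖-HasSign⁻ c<a)) hz))

symmetricProduct : ℕ → ℕ → ℤ → ℤ
symmetricProduct c zero    t = ℤ.+ 1
symmetricProduct c (suc j) t = (t ℤ.- ℤ.+ c) ℤ.* ((t ℤ.- ℤ.- ℤ.+ c) ℤ.* symmetricProduct (c + 2) j t)

symmetricProduct-below : ∀ c j t → ∣ t ∣ < suc c → HasSign (-1^ j) (symmetricProduct (suc c) j t)
symmetricProduct-below c zero    t _   = 0 , refl
symmetricProduct-below c (suc j) t t<c =
  pair-below t c t<c (symmetricProduct-below (c + 2) j t (≤-trans t<c (s≤s (m≤m+n c 2))))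

-- The roots are ±(c+1), ±(c+3), …; |t| = c + 2i lies above the first i of them and below the
-- remaining r, so exactly the last r factor pairs are negative.
symmetricProduct-sign : ∀ c i r t → suc ∣ t ∣ ≡ suc c + (i + i) →
                        HasSign (-1^ r) (symmetricProduct (suc c) (i + r) t)
symmetricProduct-sign c zero    r t t≡c =
  symmetricProduct-below c r t (≤-reflexive (trans t≡c (cong suc (+-identityʳ c))))
symmetricProduct-sign c (suc i) r t t≡c+2i =
  pair-above t c c<t (symmetricProduct-sign (c + 2) i r t (trans t≡c+2i (shift c i)))
  where
  shift : ∀ c i → suc c + (suc i + suc i) ≡ suc (c + 2) + (i + i)
  shift = solve-∀
  c<t : suc c < ∣ t ∣
  c<t = subst (suc c <_) (suc-injective (sym (trans t≡c+2i (shift c i))))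
              (≤-trans (≤-reflexive (+-comm 2 c)) (m≤m+n (c + 2) (i + i)))

rootProduct : ℤ → List ℤ → ℤ
rootProduct t = List.foldr (λ r acc → (t ℤ.- r) ℤ.* acc) (ℤ.+ 1)

rootProduct-alt : ∀ c j t → rootProduct t (List.applyUpTo (alt c) (j + j)) ≡ symmetricProduct c j t
rootProduct-alt c zero    t = refl
rootProduct-alt c (suc j) t rewrite +-suc j j =
  cong (λ p → (t ℤ.- ℤ.+ c) ℤ.* ((t ℤ.- ℤ.- ℤ.+ c) ℤ.* p)) (rootProduct-alt (c + 2) j t)

starRoots-even : ∀ n d → n % 2 ≡ 0 → starRoots n d ≡ List.map candOdd (List.upTo d)
starRoots-even n d n%2≡0 with n % 2 | n%2≡0
... | _ | refl = refl

starRoots-odd : ∀ n d → n % 2 ≡ 1 → starRoots n d ≡ List.map candEven (List.upTo d)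
starRoots-odd n d n%2≡1 with n % 2 | n%2≡1
... | _ | refl = refl

pStar-even : ∀ j t → pStar (2 + (j + j)) (j + j) t ≡ symmetricProduct 1 j t
pStar-even j t = begin
  rootProduct t (starRoots (2 + (j + j)) (j + j))
    ≡⟨ cong (rootProduct t) (starRoots-even (2 + (j + j)) (j + j)
                                            (trans (cong (_% 2) (double j)) (m*n%n≡0 (suc j) 2))) ⟩
  rootProduct t (List.map candOdd (List.upTo (j + j)))
    ≡⟨ cong (rootProduct t) (ListP.map-upTo candOdd (j + j)) ⟩
  rootProduct t (List.applyUpTo (alt 1) (j + j))
    ≡⟨ rootProduct-alt 1 j t ⟩
  symmetricProduct 1 j t ∎
  where
  open ≡-Reasoning
  double : ∀ j → 2 + (j + j) ≡ suc j * 2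
  double = solve-∀

pStar-odd : ∀ j t → pStar (3 + (j + j)) (1 + (j + j)) t ≡ t ℤ.* symmetricProduct 2 j t
pStar-odd j t = begin
  rootProduct t (starRoots (3 + (j + j)) (1 + (j + j)))
    ≡⟨ cong (rootProduct t) (starRoots-odd (3 + (j + j)) (1 + (j + j))
                                           (trans (cong (_% 2) (double+1 j)) ([m+kn]%n≡m%n 1 (suc j) 2))) ⟩
  rootProduct t (List.map candEven (List.upTo (1 + (j + j))))
    ≡⟨ cong (rootProduct t) (ListP.map-upTo candEven (1 + (j + j))) ⟩
  (t ℤ.- ℤ.+ 0) ℤ.* rootProduct t (List.applyUpTo (alt 2) (j + j))
    ≡⟨ cong₂ ℤ._*_ (ℤP.+-identityʳ t) (rootProduct-alt 2 j t) ⟩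
  t ℤ.* symmetricProduct 2 j t ∎
  where
  open ≡-Reasoning
  double+1 : ∀ j → 3 + (j + j) ≡ 1 + suc j * 2
  double+1 = solve-∀

pStar-sign-even : ∀ {m} i r t → m ≡ (i + r) + (i + r) → ∣ t ∣ ≡ i + i → sgnℤ (pStar (2 + m) m t) ≡ -1^ r
pStar-sign-even i r t refl ∣t∣≡2i =
  trans (cong sgnℤ (pStar-even (i + r) t)) (sgnℤ-HasSign (symmetricProduct-sign 0 i r t (cong suc ∣t∣≡2i)))

pStar-sign-odd : ∀ {m} i r t → m ≡ suc ((i + r) + (i + r)) → ∣ t ∣ ≡ suc (i + i) →
                 sgnℤ (pStar (2 + m) m t) ≡ ℤ.sign t Sign.* -1^ r
pStar-sign-odd i r t refl ∣t∣≡2i+1 =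
  trans (cong sgnℤ (pStar-odd (i + r) t))
        (sgnℤ-HasSign (HasSign-* (HasSign-sign t ∣t∣≡2i+1) (symmetricProduct-sign 1 i r t (cong suc ∣t∣≡2i+1))))

⊖-view : ∀ a b → (∃ λ k → a ≡ b + k × a ⊖ b ≡ ℤ.+ k) ⊎ (∃ λ k → b ≡ a + suc k × a ⊖ b ≡ -[1+ k ])
⊖-view a       zero    = inj₁ (a , refl , refl)
⊖-view zero    (suc b) = inj₂ (b , refl , refl)
⊖-view (suc a) (suc b) with ⊖-view a b
... | inj₁ (k , a≡b+k , a⊖b≡k)  = inj₁ (k , cong suc a≡b+k , trans (ℤP.[1+m]⊖[1+n]≡m⊖n a b) a⊖b≡k)
... | inj₂ (k , b≡a+k , a⊖b≡-k) = inj₂ (k , cong suc b≡a+k , trans (ℤP.[1+m]⊖[1+n]≡m⊖n a b) a⊖b≡-k)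

even-or-odd : ∀ k → ∃ λ i → k ≡ i + i ⊎ k ≡ suc (i + i)
even-or-odd zero = 0 , inj₁ refl
even-or-odd (suc k) with even-or-odd k
... | i , inj₁ k≡2i   = i , inj₂ (cong suc k≡2i)
... | i , inj₂ k≡2i+1 = suc i , inj₁ (trans (cong suc k≡2i+1) (cong suc (sym (+-suc i i))))

pStar-sign : ∀ m a b → a + b ≡ m → sgnℤ (pStar (2 + m) m (a ⊖ b)) ≡ -1^ b
pStar-sign m a b a+b≡m with ⊖-view a b
... | inj₁ (k , refl , a⊖b≡k) rewrite a⊖b≡k with even-or-odd k
...   | i , inj₁ refl = pStar-sign-even i b (ℤ.+ (i + i)) (trans (sym a+b≡m) (arith b i)) refl
  where
  arith : ∀ b i → b + (i + i) + b ≡ (i + b) + (i + b)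
  arith = solve-∀
...   | i , inj₂ refl = pStar-sign-odd i b (ℤ.+ suc (i + i)) (trans (sym a+b≡m) (arith b i)) refl
  where
  arith : ∀ b i → b + suc (i + i) + b ≡ suc ((i + b) + (i + b))
  arith = solve-∀
pStar-sign m a b a+b≡m | inj₂ (k , refl , a⊖b≡-k) rewrite a⊖b≡-k with even-or-odd k
...   | i , inj₁ refl = trans (pStar-sign-odd i a -[1+ i + i ] (trans (sym a+b≡m) (arith a i)) refl)
                              (sym (-1^-+-odd a i))
  where
  arith : ∀ a i → a + (a + suc (i + i)) ≡ suc ((i + a) + (i + a))
  arith = solve-∀
...   | i , inj₂ refl = trans (pStar-sign-even (suc i) a -[1+ suc (i + i) ] (trans (sym a+b≡m) (arith a i)) 2+2i≡)
                              (sym (-1^-+-even a (suc (suc (i + i))) (suc i) 2+2i≡))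
  where
  arith : ∀ a i → a + (a + suc (suc (i + i))) ≡ (suc i + a) + (suc i + a)
  arith = solve-∀
  2+2i≡ : suc (suc (i + i)) ≡ suc i + suc i
  2+2i≡ = cong suc (sym (+-suc i i))

-- The twisted threshold function f*·χ

plusCount minusCount : ∀ {n} → Point n → ℕ
plusCount []           = 0
plusCount (Sign.+ ∷ x) = suc (plusCount x)
plusCount (Sign.- ∷ x) = plusCount x
minusCount []           = 0
minusCount (Sign.+ ∷ x) = minusCount x
minusCount (Sign.- ∷ x) = suc (minusCount x)

plusCount+minusCount : ∀ {n} (x : Point n) → plusCount x + minusCount x ≡ n
plusCount+minusCount []           = refl
plusCount+minusCount (Sign.+ ∷ x) = cong suc (plusCount+minusCount x)
plusCount+minusCount (Sign.- ∷ x) = trans (+-suc (plusCount x) (minusCount x)) (cong suc (plusCount+minusCount x))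

sumPoint≡plusCount⊖minusCount : ∀ {n} (x : Point n) → sumPoint x ≡ plusCount x ⊖ minusCount x
sumPoint≡plusCount⊖minusCount []           = refl
sumPoint≡plusCount⊖minusCount (Sign.+ ∷ x) =
  trans (cong (λ t → ℤ.+ 1 ℤ.+ t) (sumPoint≡plusCount⊖minusCount x))
        (ℤP.distribʳ-⊖-+-pos 1 (plusCount x) (minusCount x))
sumPoint≡plusCount⊖minusCount (Sign.- ∷ x) =
  trans (cong (λ t → ℤ.-[1+ 0 ] ℤ.+ t) (sumPoint≡plusCount⊖minusCount x))
        (ℤP.distribʳ-⊖-+-neg 0 (plusCount x) (minusCount x))

χ≡-1^minusCount : ∀ {n} (x : Point n) → χ x ≡ -1^ minusCount x
χ≡-1^minusCount []           = refl
χ≡-1^minusCount (Sign.+ ∷ x) = χ≡-1^minusCount x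
χ≡-1^minusCount (Sign.- ∷ x) = cong opposite (χ≡-1^minusCount x)

plusCount≡0 : ∀ {n} (x : Point n) → plusCount x ≡ 0 → x ≡ Vec.replicate n Sign.-
plusCount≡0 []           _  = refl
plusCount≡0 (Sign.- ∷ x) x₊≡0 = cong (Sign.- ∷_) (plusCount≡0 x x₊≡0)

minusCount≡0 : ∀ {n} (x : Point n) → minusCount x ≡ 0 → x ≡ Vec.replicate n Sign.+
minusCount≡0 []           _  = refl
minusCount≡0 (Sign.+ ∷ x) x₋≡0 = cong (Sign.+ ∷_) (minusCount≡0 x x₋≡0)

fStar·χ-interior : ∀ m (x : Point (2 + m)) → x ≢ Vec.replicate _ Sign.+ → x ≢ Vec.replicate _ Sign.- →
                   (fStar (2 + m) m ·χ) x ≡ Sign.-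
fStar·χ-interior m x x≢+ x≢- with plusCount x in x₊ | minusCount x in x₋
... | zero  | _     = contradiction (plusCount≡0 x x₊) x≢-
... | suc _ | zero  = contradiction (minusCount≡0 x x₋) x≢+
... | suc a | suc b = begin
  sgnℤ (pStar (2 + m) m (sumPoint x)) Sign.* χ x
    ≡⟨ cong₂ (λ t s → sgnℤ (pStar (2 + m) m t) Sign.* s)
             (trans (sumPoint≡plusCount⊖minusCount x) (cong₂ _⊖_ x₊ x₋))
             (trans (χ≡-1^minusCount x) (cong -1^_ x₋)) ⟩
  sgnℤ (pStar (2 + m) m (suc a ⊖ suc b)) Sign.* opposite (-1^ b)
    ≡⟨ cong (λ s → s Sign.* opposite (-1^ b))
            (trans (cong (sgnℤ ∘ pStar (2 + m) m) (ℤP.[1+m]⊖[1+n]≡m⊖n a b)) (pStar-sign m a b a+b≡m)) ⟩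
  -1^ b Sign.* opposite (-1^ b)
    ≡⟨ SignP.s*opposite[s]≡- (-1^ b) ⟩
  Sign.- ∎
  where
  open ≡-Reasoning
  a+b≡m : a + b ≡ m
  a+b≡m = suc-injective (suc-injective (begin
    suc (suc (a + b))          ≡⟨ cong suc (+-suc a b) ⟨
    suc a + suc b              ≡⟨ cong₂ _+_ x₊ x₋ ⟨
    plusCount x + minusCount x ≡⟨ plusCount+minusCount x ⟩
    suc (suc m)                ∎))

constant-off-corners⇒∑differ≤2 : ∀ m (h : Point (suc m) → Sign) c →
                   (∀ x → x ≢ Vec.replicate _ Sign.+ → x ≢ Vec.replicate _ Sign.- → h x ≡ c) →
                   ∑ (suc m) (λ x → differ (h x) c) ≤ 2
constant-off-corners⇒∑differ≤2 m h c interior = begin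
  ∑ m (λ v → differ (h (Sign.+ ∷ v)) c) + ∑ m (λ v → differ (h (Sign.- ∷ v)) c)
    ≡⟨ cong₂ _+_ (∑-point m _ (Vec.replicate m Sign.+) λ v v≢ → vanish (interior _ (v≢ ∘ ∷-injectiveʳ) λ ()))
                 (∑-point m _ (Vec.replicate m Sign.-) λ v v≢ → vanish (interior _ (λ ()) (v≢ ∘ ∷-injectiveʳ))) ⟩
  differ (h (Vec.replicate _ Sign.+)) c + differ (h (Vec.replicate _ Sign.-)) c
    ≤⟨ +-mono-≤ (differ≤1 (h (Vec.replicate _ Sign.+)) c) (differ≤1 (h (Vec.replicate _ Sign.-)) c) ⟩
  2 ∎
  where
  open ≤-Reasoning
  vanish : ∀ {a} → a ≡ c → differ a c ≡ 0
  vanish refl = differ-self c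

fStar·χ-upperBound : ∀ m → D (2 + m) (fStar (2 + m) m ·χ) ≤ (2 + m) + (2 + m)
fStar·χ-upperBound m = begin
  D (2 + m) (fStar (2 + m) m ·χ)
    ≤⟨ D≤n*∑differ (2 + m) (fStar (2 + m) m ·χ) Sign.- ⟩
  (2 + m) * ∑ (2 + m) (λ x → differ ((fStar (2 + m) m ·χ) x) Sign.-)
    ≤⟨ *-monoʳ-≤ (2 + m) (constant-off-corners⇒∑differ≤2 (suc m) _ Sign.- (fStar·χ-interior m)) ⟩
  (2 + m) * 2
    ≡⟨ *-comm (2 + m) 2 ⟩
  (2 + m) + ((2 + m) + 0)
    ≡⟨ cong ((2 + m) +_) (+-identityʳ (2 + m)) ⟩
  (2 + m) + (2 + m) ∎
  where open ≤-Reasoning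

PTF·χ-lowerBound : ∀ m (f : Point (2 + m) → Sign) → IsPTF (2 + m) m f → (2 + m) + (2 + m) ≤ D (2 + m) (f ·χ)
PTF·χ-lowerBound m f (p , deg≤m , rep) =
  nonConstantFacets⇒2N≤D (suc m) (f ·χ) (PTF-facet-nonConstant (suc m) p f rep (All.map s≤s deg≤m))

mainTheorem10 : (n : ℕ) (f : Point n → Sign) → IsPTF n (n ∸ 2) f →
    dichromatic n f ≤ dichromatic n (fStar n (n ∸ 2))
mainTheorem10 zero          f _   = z≤n
mainTheorem10 (suc zero)    f ptf = ≤-trans (≤-reflexive (trans (dichromatic≡D 1 f) (degree0-PTF-D≡0 1 f ptf))) z≤n
mainTheorem10 (suc (suc m)) f ptf = begin
  dichromatic N f    ≡⟨ dichromatic≡D N f ⟩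
  D N f              ≤⟨ +-cancelʳ-≤ (D N (f ·χ)) (D N f) (D N f*) (begin
    D N f + D N (f ·χ)   ≡⟨ trans (D+D·χ N f) (sym (D+D·χ N f*)) ⟩
    D N f* + D N (f* ·χ) ≤⟨ +-monoʳ-≤ (D N f*) (≤-trans (fStar·χ-upperBound m) (PTF·χ-lowerBound m f ptf)) ⟩
    D N f* + D N (f ·χ)  ∎) ⟩
  D N f*             ≡⟨ dichromatic≡D N f* ⟨
  dichromatic N f*   ∎
  where
  open ≤-Reasoning
  N = suc (suc m)
  f* = fStar N m
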